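{- Greedy matching of a set of $n$ points can be performed in time $O(n^2\log^2 n)$ and space $O(n)$. It can also be performed in time $O(n^2)$.
   Context: The input is a set of $n$ points (arbitrary objects) with a (symmetric) distance function $d$ whose values are only assumed to be totally ordered; each point is stored in constant space, $d$ is evaluated in constant time, and two distances are compared in constant time. The greedy matching is found by repeatedly selecting a pair of distinct remaining points with minimum distance (for a minimum-weight matching) or with maximum distance (for a maximum-weight matching), adding it to the matching, and removing both points, until fewer than two points remain. Ties may be broken arbitrarily. -}

module Defs where

open import Data.Bool.Base using (Bool; true; false; if_then_else_)
open import Data.List.Base using (List; []; _∷_; length)
open import Data.List.Membership.Propositional using (_∈_)
open import Data.List.Relation.Binary.Permutation.Propositional using (_↭_)
open import Data.List.Relation.Unary.Unique.Propositional using (Unique)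
open import Data.Nat.Base using (ℕ; zero; suc; _+_; _*_; _∸_; _^_; _≤_; _<_)
open import Data.Nat.Logarithm using (⌊log₂_⌋)
open import Data.Nat.Properties using (_≟_; _<?_)
open import Data.Product.Base using (∃; ∃₂; _×_; _,_)
open import Level using (Level; _⊔_) renaming (suc to lsuc)
open import Relation.Binary.Bundles using (DecTotalOrder)
open import Relation.Binary.PropositionalEquality.Core using (_≡_; _≢_)
open import Relation.Nullary.Decidable.Core using (does)

infix 4 _∈O_

_∈O_ : (ℕ → ℕ) → (ℕ → ℕ) → Set
f ∈O g = ∃₂ λ c n₀ → ∀ n → n₀ ≤ n → f n ≤ c * g n

------------------------------------------------------------------------
-- Greedy matchings

data Objective : Set where
  minimum maximum : Objective

module Greedy
  {a b ℓ₁ ℓ₂} {P : Set a} (D : DecTotalOrder b ℓ₁ ℓ₂)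
  (d : P → P → DecTotalOrder.Carrier D) (obj : Objective)
  where

  open DecTotalOrder D using (Carrier) renaming (_≤_ to _≤ᴰ_)

  AtLeastAsGood : Objective → Carrier → Carrier → Set ℓ₂
  AtLeastAsGood minimum e f = e ≤ᴰ f
  AtLeastAsGood maximum e f = f ≤ᴰ e

  -- GreedyRun xs m: started on the points xs, some run of the greedy
  -- procedure selects the pairs m, in this order.  Since xs will be free of
  -- duplicates, the two selected points are distinct.
  data GreedyRun : List P → List (P × P) → Set (a ⊔ ℓ₂) where
    stop   : ∀ {xs} → length xs < 2 → GreedyRun xs []
    select : ∀ {xs ys p q m} →
             xs ↭ p ∷ q ∷ ys →
             (∀ {r s} → r ∈ xs → s ∈ xs → r ≢ s →
                AtLeastAsGood obj (d p q) (d r s)) →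
             GreedyRun ys m →
             GreedyRun xs ((p , q) ∷ m)

  -- A matching is a set of pairs, so the order in which the pairs are listed
  -- is irrelevant; GreedyRun may orient each selected pair either way.
  IsGreedyMatching : List P → List (P × P) → Set (a ⊔ ℓ₂)
  IsGreedyMatching xs m = ∃ λ m′ → GreedyRun xs m′ × m ↭ m′

------------------------------------------------------------------------
-- Random access machine programs.  A program mentions only finitely many
-- registers and does not depend on the input in any way.

Reg : Set
Reg = ℕ

data Instr : Set where
  const  : (x : Reg) (k : ℕ) → Instr    -- x := k
  copy   : (x y : Reg) → Instr          -- x := y
  add    : (x y z : Reg) → Instr        -- x := y + z
  sub    : (x y z : Reg) → Instr        -- x := y ∸ z
  load   : (x y : Reg) → Instr          -- x := mem[y]
  store  : (x y : Reg) → Instr          -- mem[x] := y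
  dist   : (x y z : Reg) → Instr        -- x := d(y , z)
  report : (x y : Reg) → Instr          -- output the pair (x , y)

data Test : Set where
  equal   : (x y : Reg) → Test          -- numbers: x ≡ y
  less    : (x y : Reg) → Test          -- numbers: x < y
  compare : (x y : Reg) → Test          -- distances: x ≤ y

infixr 5 _⨾_

data Prog : Set where
  skip  : Prog
  instr : Instr → Prog
  _⨾_   : Prog → Prog → Prog
  cond  : Test → Prog → Prog → Prog
  while : Test → Prog → Prog

-- The machine has `space` memory cells and words of `width` bits.  It gets
-- stuck (no transition exists) on an access outside the memory, on overflow,
-- and on operands of the wrong sort.  Points and distances are opaque: each
-- fits in one cell, and they can only be moved, measured, compared and output.
module Machine
  {a b ℓ₁ ℓ₂} {P : Set a} (D : DecTotalOrder b ℓ₁ ℓ₂)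
  (d : P → P → DecTotalOrder.Carrier D) (space width : ℕ)
  where

  open DecTotalOrder D using (Carrier) renaming (_≤?_ to _≤ᴰ?_)

  data Value : Set (a ⊔ b) where
    number   : ℕ → Value
    point    : P → Value
    distance : Carrier → Value

  record State : Set (a ⊔ b) where
    constructor state
    field
      reg : Reg → Value
      mem : ℕ → Value
      out : List (P × P)

  open State public

  update : (ℕ → Value) → ℕ → Value → (ℕ → Value)
  update f i v j = if does (i ≟ j) then v else f j

  setReg : Reg → Value → State → State
  setReg x v σ = record σ { reg = update (reg σ) x v }

  setMem : ℕ → Value → State → State
  setMem i v σ = record σ { mem = update (mem σ) i v }

  emit : P → P → State → State
  emit p q σ = record σ { out = (p , q) ∷ out σ }

  data Step (σ : State) : Instr → State → Set (a ⊔ b) where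
    const  : ∀ {x k} → k < 2 ^ width →
             Step σ (const x k) (setReg x (number k) σ)
    copy   : ∀ {x y} →
             Step σ (copy x y) (setReg x (reg σ y) σ)
    add    : ∀ {x y z m n} → reg σ y ≡ number m → reg σ z ≡ number n →
             m + n < 2 ^ width →
             Step σ (add x y z) (setReg x (number (m + n)) σ)
    sub    : ∀ {x y z m n} → reg σ y ≡ number m → reg σ z ≡ number n →
             Step σ (sub x y z) (setReg x (number (m ∸ n)) σ)
    load   : ∀ {x y i} → reg σ y ≡ number i → i < space →
             Step σ (load x y) (setReg x (mem σ i) σ)
    store  : ∀ {x y i} → reg σ x ≡ number i → i < space →
             Step σ (store x y) (setMem i (reg σ y) σ)
    dist   : ∀ {x y z p q} → reg σ y ≡ point p → reg σ z ≡ point q →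
             Step σ (dist x y z) (setReg x (distance (d p q)) σ)
    report : ∀ {x y p q} → reg σ x ≡ point p → reg σ y ≡ point q →
             Step σ (report x y) (emit p q σ)

  data Eval (σ : State) : Test → Bool → Set (a ⊔ b) where
    equal   : ∀ {x y m n} → reg σ x ≡ number m → reg σ y ≡ number n →
              Eval σ (equal x y) (does (m ≟ n))
    less    : ∀ {x y m n} → reg σ x ≡ number m → reg σ y ≡ number n →
              Eval σ (less x y) (does (m <? n))
    compare : ∀ {x y e f} → reg σ x ≡ distance e → reg σ y ≡ distance f →
              Eval σ (compare x y) (does (e ≤ᴰ? f))

  -- Run π σ t τ: started in σ, π halts in τ after exactly t time units.
  data Run : Prog → State → ℕ → State → Set (a ⊔ b) where
    skip       : ∀ {σ} → Run skip σ 1 σ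
    instr      : ∀ {i σ τ} → Step σ i τ → Run (instr i) σ 1 τ
    _⨾_        : ∀ {π₁ π₂ σ ρ τ t u} →
                 Run π₁ σ t ρ → Run π₂ ρ u τ → Run (π₁ ⨾ π₂) σ (t + u) τ
    cond       : ∀ {c v π₁ π₂ σ τ t} → Eval σ c v →
                 Run (if v then π₁ else π₂) σ t τ →
                 Run (cond c π₁ π₂) σ (suc t) τ
    while-stop : ∀ {c π σ} → Eval σ c false → Run (while c π) σ 1 σ
    while-step : ∀ {c π σ ρ τ t u} → Eval σ c true →
                 Run π σ t ρ → Run (while c π) ρ u τ →
                 Run (while c π) σ (suc (t + u)) τ

  inputCells : List P → ℕ → Value
  inputCells []       _       = number 0
  inputCells (x ∷ _)  zero    = point x
  inputCells (_ ∷ xs) (suc i) = inputCells xs i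

  -- The points occupy the first cells of the memory, and register 0 holds
  -- their number.
  initial : List P → State
  initial xs = state (update (λ _ → number 0) 0 (number (length xs)))
                     (inputCells xs) []

------------------------------------------------------------------------
-- GreedyMatchingIn … T S: a single program finds greedy matchings of n points
-- in time T n, on a machine with S n memory cells and words of O(log n) bits.

module _ (a b ℓ₁ ℓ₂ : Level) where

  GreedyMatchingIn : Objective → (T S : ℕ → ℕ) → Set (lsuc (a ⊔ b ⊔ ℓ₁ ⊔ ℓ₂))
  GreedyMatchingIn obj T S =
    ∃₂ λ (π : Prog) (width : ℕ → ℕ) →
      width ∈O ⌊log₂_⌋ ×
      (∀ n → n < 2 ^ width n) ×
      (∀ n → n ≤ S n) ×
      (∀ (P : Set a) (D : DecTotalOrder b ℓ₁ ℓ₂)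
         (d : P → P → DecTotalOrder.Carrier D) →
         (∀ p q → DecTotalOrder._≈_ D (d p q) (d q p)) →
         (xs : List P) → Unique xs →
         let n = length xs
             open Machine D d (S n) (width n)
             open Greedy D d obj
         in ∃₂ λ t τ → t ≤ T n × Run π (initial xs) t τ ×
                       IsGreedyMatching xs (out τ))

{-# OPTIONS --safe #-}
-- Both bounds are achieved by the nearest-neighbour chain algorithm.  It keeps
-- a stack of points, each one nearest to the point below it among the points
-- not deeper in the stack, with improving distances towards the top.  If no
-- free point is strictly nearer to the top than the second point is, the two
-- top points dominate every pair they meet and are matched; otherwise the free
-- point nearest to the top is pushed.  Each step scans the free points once and
-- lowers 2 · (number of free points) + (height of the stack), so the time is
-- O(n²), and the stack and the free points share the n cells of the input.
-- The dominant pairs are not found in greedy order, but inserting one into a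
-- greedy run on the remaining points, in order of distance, yields a greedy run.
module Submission where

open import Data.Bool.Base using (Bool; true; false; if_then_else_)
open import Data.List.Base using (List; []; _∷_; _++_; length)
open import Data.List.Membership.Propositional using (_∈_)
open import Data.List.Membership.Propositional.Properties using (∈-++⁻)
open import Data.List.Properties using (++-identityʳ)
open import Data.List.Relation.Binary.Permutation.Propositional
open import Data.List.Relation.Binary.Permutation.Propositional.Properties
  using (∈-resp-↭; ↭-length; shift; shifts; ++⁺ˡ; ++⁺ʳ)
open import Data.List.Relation.Unary.Any using (here; there)
open import Data.Nat.Base hiding (compare; _⊔_)
open import Data.Nat.Logarithm using (⌊log₂_⌋; ⌊log₂⌋-mono-≤; ⌊log₂[2^n]⌋≡n)
open import Data.Nat.Properties
open import Data.Product.Base using (∃; ∃₂; _×_; _,_; proj₁; proj₂)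
open import Data.Sum.Base using (_⊎_; inj₁; inj₂; [_,_]′)
open import Data.Unit.Polymorphic.Base using (⊤; tt)
open import Function.Base using (_∘_; id)
open import Level using (Level; _⊔_)
open import Relation.Binary.Bundles using (DecTotalOrder)
open import Relation.Binary.PropositionalEquality.Core
  using (_≡_; _≢_; refl; cong; subst) renaming (sym to ≡-sym; trans to ≡-trans)
open import Relation.Nullary.Decidable using (dec-true; dec-false; yes; no)
open import Relation.Nullary.Negation using (contradiction)
open import Defs

-- Logarithms and the word width.

n<2^[1+⌊log₂n⌋] : ∀ n → n < 2 ^ suc ⌊log₂ n ⌋
n<2^[1+⌊log₂n⌋] n = ≰⇒> λ p →
  <-irrefl refl (subst (_≤ ⌊log₂ n ⌋) (⌊log₂[2^n]⌋≡n (suc ⌊log₂ n ⌋)) (⌊log₂⌋-mono-≤ p))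

1≤⌊log₂n⌋ : ∀ {n} → 2 ≤ n → 1 ≤ ⌊log₂ n ⌋
1≤⌊log₂n⌋ 2≤n = ⌊log₂⌋-mono-≤ 2≤n

-- The random access machine program.

-- The stack occupies the cells below k#, its top in cell k# ∸ 1, and the free
-- points occupy the cells from w# up to n#; b# holds the best free point so far
-- and e# its distance to the top c#.
pattern n#    = 0
pattern w#    = 1
pattern k#    = 2
pattern one#  = 3
pattern zero# = 4
pattern i#    = 5
pattern c#    = 6
pattern b#    = 7
pattern e#    = 8
pattern j#    = 9
pattern x#    = 10
pattern f#    = 11
pattern a#    = 12

better : Objective → Reg → Reg → Test
better minimum x y = compare x y
better maximum x y = compare y x

push : Prog
push = instr (store k# b#) ⨾ instr (add k# one# k#)

matchTop : Prog
-- `i#` already holds the height minus two, and the best free point returns to the cell vacated just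
-- below the free segment.
matchTop = instr (report c# a#) ⨾ instr (copy k# i#) ⨾
           instr (sub w# w# one#) ⨾ instr (store w# b#)

module Program (obj : Objective) where

  -- Keeps the losing point of each comparison in the scanned cell, so that the
  -- free points without the winner stay contiguous.
  scanBody : Prog
  scanBody =
    instr (load x# j#) ⨾ instr (dist f# c# x#) ⨾
    cond (better obj e# f#)
      (instr (add j# one# j#))
      (instr (store j# b#) ⨾ instr (copy b# x#) ⨾ instr (copy e# f#) ⨾
       instr (add j# one# j#))

  scan : Prog
  scan = while (less j# n#) scanBody

  matchOrPush : Prog
  matchOrPush =
    instr (sub i# i# one#) ⨾ instr (load a# i#) ⨾ instr (dist f# c# a#) ⨾
    cond (better obj f# e#) matchTop push

  extend : Prog
  extend =
    instr (sub i# k# one#) ⨾ instr (load c# i#) ⨾ instr (dist e# c# b#) ⨾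
    instr (copy j# w#) ⨾ scan ⨾ cond (equal k# one#) push matchOrPush

  -- Taking the first free point into `b#` vacates its cell, so that a push has room even when the
  -- stack touches the free segment.
  growBody : Prog
  growBody = instr (load b# w#) ⨾ instr (add w# one# w#) ⨾
             cond (equal k# zero#) push extend

  grow : Prog
  grow = while (less w# n#) growBody

  unwindBody : Prog
  unwindBody = instr (sub k# k# one#) ⨾ instr (load c# k#) ⨾
               instr (sub k# k# one#) ⨾ instr (load a# k#) ⨾
               instr (report c# a#)

  unwind : Prog
  unwind = while (less one# k#) unwindBody

  program : Prog
  program = instr (const one# 1) ⨾ grow ⨾ unwind

-- Greedy runs and dominant pairs.

module Dominance
  {α β ℓ₁ ℓ₂} {P : Set α} (D : DecTotalOrder β ℓ₁ ℓ₂)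
  (d : P → P → DecTotalOrder.Carrier D)
  (d-sym : ∀ p q → DecTotalOrder._≈_ D (d p q) (d q p))
  (obj : Objective)
  where

  private module D = DecTotalOrder D
  open Greedy D d obj

  infix 4 _≼_
  _≼_ : D.Carrier → D.Carrier → Set ℓ₂
  _≼_ = AtLeastAsGood obj

  ≼-reflexive : ∀ {e f} → e D.≈ f → e ≼ f
  ≼-reflexive = go obj
    where
    go : ∀ o {e f} → e D.≈ f → AtLeastAsGood o e f
    go minimum e≈f = D.reflexive e≈f
    go maximum e≈f = D.reflexive (D.Eq.sym e≈f)

  ≼-refl : ∀ {e} → e ≼ e
  ≼-refl = ≼-reflexive D.Eq.refl

  ≼-trans : ∀ {e f g} → e ≼ f → f ≼ g → e ≼ g
  ≼-trans = go obj
    where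
    go : ∀ o {e f g} → AtLeastAsGood o e f → AtLeastAsGood o f g → AtLeastAsGood o e g
    go minimum p q = D.trans p q
    go maximum p q = D.trans q p

  ≼-total : ∀ e f → e ≼ f ⊎ f ≼ e
  ≼-total = go obj
    where
    go : ∀ o e f → AtLeastAsGood o e f ⊎ AtLeastAsGood o f e
    go minimum e f = D.total e f
    go maximum e f = D.total f e

  ≼-flipˡ : ∀ {p q e} → d p q ≼ e → d q p ≼ e
  ≼-flipˡ = ≼-trans (≼-reflexive (d-sym _ _))

  ≼-flipʳ : ∀ {p q e} → e ≼ d p q → e ≼ d q p
  ≼-flipʳ p = ≼-trans p (≼-reflexive (d-sym _ _))

  GreedyRun-resp-↭ : ∀ {xs ys m} → xs ↭ ys → GreedyRun xs m → GreedyRun ys m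
  GreedyRun-resp-↭ xs↭ys (stop short) = stop (subst (_< 2) (↭-length xs↭ys) short)
  GreedyRun-resp-↭ xs↭ys (select split best run) =
    select (trans (↭-sym xs↭ys) split)
      (λ r∈ s∈ → best (∈-resp-↭ (↭-sym xs↭ys) r∈) (∈-resp-↭ (↭-sym xs↭ys) s∈)) run

  LowerBound : D.Carrier → List P → Set (α ⊔ ℓ₂)
  LowerBound e xs = ∀ {r s} → r ∈ xs → s ∈ xs → r ≢ s → e ≼ d r s

  -- Mutual nearest neighbours, up to ties.
  Dominant : P → P → List P → Set (α ⊔ ℓ₂)
  Dominant p q ys = ∀ {x} → x ∈ ys → d p q ≼ d p x × d p q ≼ d q x

  lowerBound-short : ∀ {e xs} → length xs < 2 → LowerBound e xs
  lowerBound-short {xs = _ ∷ []}    _ (here refl) (here refl) r≢s = contradiction refl r≢s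
  lowerBound-short {xs = _ ∷ _ ∷ _} (s≤s (s≤s ()))

  -- A pair is `(p , q)` up to orientation, shares one point with it, or lies in `ys`; dominance
  -- reduces the second case to the first.
  lowerBound-pair : ∀ {e p q ys} → e ≼ d p q → Dominant p q ys → LowerBound e ys →
                    LowerBound e (p ∷ q ∷ ys)
  lowerBound-pair {e} {p} {q} {ys} e≼pq dom lb = go
    where
    go : LowerBound e (p ∷ q ∷ ys)
    go (here refl)         (here refl)         r≢s = contradiction refl r≢s
    go (here refl)         (there (here refl)) _   = e≼pq
    go (here refl)         (there (there s∈))  _   = ≼-trans e≼pq (proj₁ (dom s∈))
    go (there (here refl)) (here refl)         _   = ≼-flipʳ e≼pq
    go (there (here refl)) (there (here refl)) r≢s = contradiction refl r≢s
    go (there (here refl)) (there (there s∈))  _   = ≼-trans e≼pq (proj₂ (dom s∈))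
    go (there (there r∈))  (here refl)         _   = ≼-flipʳ (≼-trans e≼pq (proj₁ (dom r∈)))
    go (there (there r∈))  (there (here refl)) _   = ≼-flipʳ (≼-trans e≼pq (proj₂ (dom r∈)))
    go (there (there r∈))  (there (there s∈))  r≢s = lb r∈ s∈ r≢s

  -- Induction on the run. If `d p q` is at least as good as the first selected distance, it bounds
  -- all pairs and `(p , q)` goes first. Otherwise the first pair stays best, since `d p q` bounds
  -- every new pair, and the insertion continues in the rest.
  insertDominant : ∀ {p q ys m} → Dominant p q ys → GreedyRun ys m →
                   ∃ λ m′ → GreedyRun (p ∷ q ∷ ys) m′ × m′ ↭ (p , q) ∷ m
  insertDominant dom run@(stop short) =
    _ , select ↭-refl (lowerBound-pair ≼-refl dom (lowerBound-short short)) run , ↭-refl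
  insertDominant {p} {q} dom run@(select {p = r} {q = s} split best rest)
    with ≼-total (d p q) (d r s)
  ... | inj₁ pq≼rs =
    _ , select ↭-refl
          (lowerBound-pair ≼-refl dom (λ x∈ y∈ x≢y → ≼-trans pq≼rs (best x∈ y∈ x≢y))) run
      , ↭-refl
  ... | inj₂ rs≼pq =
    let _ , run′ , m′↭ = insertDominant (dom ∘ ∈-resp-↭ (↭-sym split) ∘ there ∘ there) rest
    in _ , select (trans (prep p (prep q split)) (shifts (p ∷ q ∷ []) (r ∷ s ∷ [])))
             (lowerBound-pair rs≼pq dom best) run′
         , trans (prep _ m′↭) (swap _ _ ↭-refl)

  -- Nearest-neighbour chains.

  -- Chain F C: C is the stack, top first, over the free points F.  In a link,
  -- c is nearest to c′ among the points not below c′, and no pair having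
  -- exactly one point below c′ is nearer.
  data Chain : List P → List P → Set (α ⊔ ℓ₂) where
    empty  : ∀ {F} → Chain F []
    single : ∀ {F c} → Chain F (c ∷ [])
    link   : ∀ {F c c′ C} →
             (∀ {y} → y ∈ c ∷ F → d c c′ ≼ d c′ y) →
             (∀ {x y} → x ∈ C → y ∈ c′ ∷ c ∷ F → d c c′ ≼ d y x) →
             Chain (c ∷ F) (c′ ∷ C) → Chain F (c ∷ c′ ∷ C)

  -- Links only assert lower bounds over the free points. Inclusion by membership covers both
  -- removal and reordering.
  Chain-⊆ : ∀ {F G C} → (∀ {x} → x ∈ G → x ∈ F) → Chain F C → Chain G C
  Chain-⊆ G⊆F empty  = empty
  Chain-⊆ G⊆F single = single
  Chain-⊆ {F} {G} G⊆F (link {c = c} {c′} near below ch) =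
    link (near ∘ ext) (λ x∈ → below x∈ ∘ ext₂) (Chain-⊆ ext ch)
    where
    ext : ∀ {x} → x ∈ c ∷ G → x ∈ c ∷ F
    ext (here eq)  = here eq
    ext (there x∈) = there (G⊆F x∈)
    ext₂ : ∀ {x} → x ∈ c′ ∷ c ∷ G → x ∈ c′ ∷ c ∷ F
    ext₂ (here eq)  = here eq
    ext₂ (there x∈) = there (ext x∈)

  Nearest : P → P → List P → Set (α ⊔ ℓ₂)
  Nearest c b F = ∀ {y} → y ∈ F → d c b ≼ d c y

  link-single : ∀ {b c F} → Nearest c b (b ∷ F) → Chain F (b ∷ c ∷ [])
  link-single near = link (≼-flipˡ ∘ near) (λ ()) single

  -- For `x` deeper than `c` and `y` not deeper, the old link bounds `d y x` by `d c c′`, and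
  -- `d c b` is at least as good.
  link-nearer : ∀ {b c c′ C F} → Nearest c b (b ∷ F) → d c b ≼ d c c′ →
                Chain (b ∷ F) (c ∷ c′ ∷ C) → Chain F (b ∷ c ∷ c′ ∷ C)
  link-nearer {b} {c} {c′} {C} {F} near cb≼cc′ ch@(link near′ below _) =
    link (≼-flipˡ ∘ near) (λ x∈ y∈ → ≼-flipˡ (below′ x∈ y∈)) ch
    where
    below′ : ∀ {x y} → x ∈ c′ ∷ C → y ∈ c ∷ b ∷ F → d c b ≼ d y x
    below′ (here refl) y∈ = ≼-trans cb≼cc′ (≼-flipʳ (near′ y∈))
    below′ (there x∈)  y∈ = ≼-trans cb≼cc′ (below x∈ (there y∈))

  top-dominant : ∀ {c c′ C F} → (∀ {y} → y ∈ F → d c c′ ≼ d c y) →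
                 Chain F (c ∷ c′ ∷ C) → Dominant c c′ (C ++ F)
  top-dominant {C = C} near (link near′ below _) x∈ with ∈-++⁻ C x∈
  ... | inj₁ x∈C = below x∈C (there (here refl)) , below x∈C (here refl)
  ... | inj₂ x∈F = near x∈F , near′ (there x∈F)

  -- The inner links hold over a larger free set, which includes the two popped points.
  Chain-pop₂ : ∀ {c c′ C F} → Chain F (c ∷ c′ ∷ C) → Chain F C
  Chain-pop₂ (link _ _ single)        = empty
  Chain-pop₂ (link _ _ (link _ _ ch)) = Chain-⊆ (there ∘ there) ch

  -- Relative to the output `o` so far: a pair is reported before the greedy run on the remaining
  -- points is known, so the run is assembled backwards from the end of the execution.
  Solved : List (P × P) → List P → List (P × P) → Set (α ⊔ ℓ₂)
  Solved o xs o′ = ∃ λ m → GreedyRun xs m × o′ ↭ m ++ o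

  Solved-resp-↭ : ∀ {o xs ys o′} → xs ↭ ys → Solved o xs o′ → Solved o ys o′
  Solved-resp-↭ xs↭ys (m , run , o′↭) = m , GreedyRun-resp-↭ xs↭ys run , o′↭

  Solved-pair : ∀ {o p q ys o′} → Dominant p q ys → Solved ((p , q) ∷ o) ys o′ →
                Solved o (p ∷ q ∷ ys) o′
  Solved-pair {o} dom (m , run , o′↭) =
    let m′ , run′ , m′↭ = insertDominant dom run
    in m′ , run′ , trans o′↭ (trans (shift _ m o) (++⁺ʳ o (↭-sym m′↭)))

-- Executions with time bounds.

module Correctness
  {α β ℓ₁ ℓ₂} {P : Set α} (D : DecTotalOrder β ℓ₁ ℓ₂)
  (d : P → P → DecTotalOrder.Carrier D)
  (d-sym : ∀ p q → DecTotalOrder._≈_ D (d p q) (d q p))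
  (obj : Objective) (n width : ℕ) (n<2^width : n < 2 ^ width) (1<2^width : 1 < 2 ^ width)
  where

  private module D = DecTotalOrder D
  open Greedy D d obj
  open Dominance D d d-sym obj
  open Machine D d n width
  open Program obj

  private variable
    x y : Reg
    T U : ℕ
    π π₁ π₂ : Prog
    σ τ : State
    c : Test
    i : Instr
    ℓ ℓ′ : Level
    Q : State → Set ℓ
    R : State → Set ℓ′

  -- Total correctness with a time bound. The postcondition may itself be an `Exec`, so proofs
  -- follow the program in continuation style.
  Exec : ∀ {ℓ} → ℕ → Prog → State → (State → Set ℓ) → Set (α ⊔ β ⊔ ℓ)
  Exec T π σ Q = ∃₂ λ t τ → t ≤ T × Run π σ t τ × Q τ

  slower : T ≤ U → Exec T π σ Q → Exec U π σ Q
  slower T≤U (t , τ , t≤T , r , q) = t , τ , ≤-trans t≤T T≤U , r , q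

  mapExec : (∀ {τ} → Q τ → R τ) → Exec T π σ Q → Exec T π σ R
  mapExec f (t , τ , t≤T , r , q) = t , τ , t≤T , r , f q

  -- The slack `T` lets branches of different lengths share one bound.
  end : Step σ i τ → Q τ → Exec (suc T) (instr i) σ Q
  end s q = _ , _ , s≤s z≤n , instr s , q

  seq : Exec T π₁ σ (λ τ → Exec U π₂ τ Q) → Exec (T + U) (π₁ ⨾ π₂) σ Q
  seq (_ , _ , t≤ , r , _ , _ , u≤ , r′ , q) = _ , _ , +-mono-≤ t≤ u≤ , Run._⨾_ r r′ , q

  infixr 4 _▸_
  _▸_ : Step σ i τ → Exec T π τ Q → Exec (suc T) (instr i ⨾ π) σ Q
  s ▸ (_ , _ , t≤ , r , q) = _ , _ , s≤s t≤ , Run._⨾_ (instr s) r , q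

  branch : ∀ {v} → Eval σ c v → Exec T (if v then π₁ else π₂) σ Q →
           Exec (suc T) (cond c π₁ π₂) σ Q
  branch ev (_ , _ , t≤ , r , q) = _ , _ , s≤s t≤ , cond ev r , q

  loop-exit : Eval σ c false → Q σ → Exec (suc T) (while c π) σ Q
  loop-exit ev q = _ , _ , s≤s z≤n , while-stop ev , q

  loop-step : Eval σ c true → Exec T π σ (λ τ → Exec U (while c π) τ Q) →
              Exec (suc (T + U)) (while c π) σ Q
  loop-step ev (_ , _ , t≤ , r , _ , _ , u≤ , r′ , q) =
    _ , _ , s≤s (+-mono-≤ t≤ u≤) , while-step ev r r′ , q

  eval-less-true : ∀ {m l} → reg σ x ≡ number m → reg σ y ≡ number l → m < l →
                   Eval σ (less x y) true
  eval-less-true p q m<l = subst (Eval _ _) (dec-true (_ <? _) m<l) (less p q)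

  eval-less-false : ∀ {m l} → reg σ x ≡ number m → reg σ y ≡ number l → l ≤ m →
                    Eval σ (less x y) false
  eval-less-false p q l≤m = subst (Eval _ _) (dec-false (_ <? _) (≤⇒≯ l≤m)) (less p q)

  eval-better : ∀ {e f} → reg σ x ≡ distance e → reg σ y ≡ distance f →
                (Eval σ (better obj x y) true × e ≼ f) ⊎
                (Eval σ (better obj x y) false × f ≼ e)
  eval-better {σ} = go obj
    where
    compare-≤ : ∀ {x y e f} → reg σ x ≡ distance e → reg σ y ≡ distance f →
                (Eval σ (compare x y) true × e D.≤ f) ⊎
                (Eval σ (compare x y) false × f D.≤ e)
    compare-≤ {e = e} {f} p q with e D.≤? f | compare p q
    ... | yes e≤f | ev = inj₁ (ev , e≤f)
    ... | no  e≰f | ev = inj₂ (ev , [ (λ e≤f → contradiction e≤f e≰f) , id ]′ (D.total e f))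
    go : ∀ o {x y e f} → reg σ x ≡ distance e → reg σ y ≡ distance f →
         (Eval σ (better o x y) true × AtLeastAsGood o e f) ⊎
         (Eval σ (better o x y) false × AtLeastAsGood o f e)
    go minimum p q = compare-≤ p q
    go maximum p q = compare-≤ q p

  -- Lists laid out in memory.

  update-same : ∀ f i v → update f i v i ≡ v
  update-same f i v = cong (if_then v else f i) (dec-true (i ≟ i) refl)

  update-other : ∀ f {i j} v → i ≢ j → update f i v j ≡ f j
  update-other f {i} {j} v i≢j = cong (if_then v else f j) (dec-false (i ≟ j) i≢j)

  Segment : (ℕ → Value) → ℕ → List P → Set (α ⊔ β)
  Segment μ i []       = ⊤
  Segment μ i (x ∷ xs) = μ i ≡ point x × Segment μ (suc i) xs

  Stack : (ℕ → Value) → List P → Set (α ⊔ β)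
  Stack μ []      = ⊤
  Stack μ (x ∷ C) = μ (length C) ≡ point x × Stack μ C

  Segment-cong : ∀ {μ ν i} xs → (∀ {j} → i ≤ j → ν j ≡ μ j) → Segment μ i xs → Segment ν i xs
  Segment-cong []       eq _         = tt
  Segment-cong (x ∷ xs) eq (p , seg) =
    ≡-trans (eq ≤-refl) p , Segment-cong xs (eq ∘ <⇒≤) seg

  Stack-cong : ∀ {μ ν} C → (∀ {j} → j < length C → ν j ≡ μ j) → Stack μ C → Stack ν C
  Stack-cong []      eq _        = tt
  Stack-cong (x ∷ C) eq (p , st) = ≡-trans (eq ≤-refl) p , Stack-cong C (eq ∘ m≤n⇒m≤1+n) st

  Segment-shift : ∀ {μ : ℕ → Value} {i} xs → Segment (μ ∘ suc) i xs → Segment μ (suc i) xs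
  Segment-shift []       _         = tt
  Segment-shift (x ∷ xs) (p , seg) = p , Segment-shift xs seg

  Segment-input : ∀ xs → Segment (inputCells xs) 0 xs
  Segment-input []       = tt
  Segment-input (x ∷ xs) = refl , Segment-shift xs (Segment-input xs)

  Segment-store-below : ∀ {μ i j v} xs → i < j → Segment μ j xs → Segment (update μ i v) j xs
  Segment-store-below {μ} xs i<j =
    Segment-cong xs (λ j≤h → update-other μ _ (<⇒≢ (<-≤-trans i<j j≤h)))

  Stack-store-above : ∀ {μ i v} C → length C ≤ i → Stack μ C → Stack (update μ i v) C
  Stack-store-above {μ} C C≤i = Stack-cong C (λ h<C → update-other μ _ (>⇒≢ (<-≤-trans h<C C≤i)))

  -- The scan of the free points.

  Regs : State → ℕ → ℕ → Set (α ⊔ β)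
  Regs σ w k = reg σ n# ≡ number n × reg σ w# ≡ number w × reg σ k# ≡ number k ×
               reg σ one# ≡ number 1 × reg σ zero# ≡ number 0

  fits : ∀ {m} → m ≤ n → m < 2 ^ width
  fits m≤n = ≤-<-trans m≤n n<2^width

  room : ∀ j {l} → j + suc l ≡ n → suc j + l ≡ n
  room j = ≡-trans (≡-sym (+-suc j _))

  below-n : ∀ {j l} → j + l ≡ n → j ≤ n
  below-n eq = subst (_ ≤_) eq (m≤m+n _ _)

  -- `F` stands for the points still to be scanned before a scan, and for the losers after it.
  record Champion (σ : State) (w k i : ℕ) (c b : P) (j : ℕ) (F : List P) : Set (α ⊔ β) where
    constructor champion
    field
      regs : Regs σ w k
      i≡   : reg σ i# ≡ number i
      c≡   : reg σ c# ≡ point c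
      b≡   : reg σ b# ≡ point b
      e≡   : reg σ e# ≡ distance (d c b)
      seg  : Segment (mem σ) j F

  record Scanned (μ : ℕ → Value) (o : List (P × P)) (w k i : ℕ) (c b : P) (j : ℕ) (F : List P)
                 (τ : State) :
                 Set (α ⊔ β ⊔ ℓ₂) where
    constructor scanned
    field
      {b′}  : P
      {G}   : List P
      champ : Champion τ w k i c b′ j G
      perm  : b′ ∷ G ↭ b ∷ F
      near  : Nearest c b′ (b′ ∷ G)
      -- Protects the stack and, in the induction, the loser left in the preceding cell.
      frame : ∀ {h} → h < j → mem τ h ≡ μ h
      out≡  : out τ ≡ o

  -- A round costs at most eight units: the loop test, two instructions, the conditional and up to
  -- four instructions in a branch.
  scan-correct : ∀ {σ w k i c b j} F → Champion σ w k i c b j F → reg σ j# ≡ number j →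
                 j + length F ≡ n →
                 Exec (suc (length F * 8)) scan σ (Scanned (mem σ) (out σ) w k i c b j F)
  scan-correct {j = j} [] ch@(champion (n≡ , _) _ _ _ _ _) j≡ eq =
    loop-exit (eval-less-false j≡ n≡ (≤-reflexive (≡-trans (≡-sym eq) (+-identityʳ j))))
      (scanned ch ↭-refl (λ { (here refl) → ≼-refl }) (λ _ → refl) refl)
  scan-correct {σ} {w} {k} {i} {c} {b} {j} (x ∷ F)
    (champion R@(n≡ , _ , _ , one≡ , _) i≡ c≡ b≡ e≡ (x≡ , seg)) j≡ eq =
    loop-step (eval-less-true j≡ n≡ j<n) (load j≡ j<n ▸ dist c≡ x≡ ▸ choose)
    where
    j<n : j < n
    j<n = below-n (room j eq)
    σ₁ : State
    σ₁ = setReg f# (distance (d c x)) (setReg x# (mem σ j) σ)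
    -- Prepends the loser `l` in cell `j` to the result of the remaining scan, which started from
    -- the winner `b₁`: the final `b′` is at least as good as `b₁`, hence as `l`.
    keep : ∀ {μ ρ b₁ l} → d c b₁ ≼ d c l → μ j ≡ point l →
           b₁ ∷ l ∷ F ↭ b ∷ x ∷ F → (∀ {h} → h < j → μ h ≡ mem σ h) →
           Scanned μ (out σ) w k i c b₁ (suc j) F ρ →
           Scanned (mem σ) (out σ) w k i c b j (x ∷ F) ρ
    keep {b₁ = b₁} {l} b₁≼l l≡ bl↭bx frame
      (scanned {b′} {G} (champion R′ i≡′ c≡′ b≡′ e≡′ seg′) perm near frame′ out≡) =
      scanned (champion R′ i≡′ c≡′ b≡′ e≡′ (≡-trans (frame′ ≤-refl) l≡ , seg′))
        (trans (swap b′ l ↭-refl) (trans (prep l perm) (trans (swap l b₁ ↭-refl) bl↭bx)))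
        near′ (λ h<j → ≡-trans (frame′ (m≤n⇒m≤1+n h<j)) (frame h<j)) out≡
      where
      near′ : Nearest c b′ (b′ ∷ l ∷ G)
      near′ (here refl)         = ≼-refl
      near′ (there (here refl)) = ≼-trans (near (∈-resp-↭ (↭-sym perm) (here refl))) b₁≼l
      near′ (there (there y∈))  = near (there y∈)
    choose : Exec 5 _ σ₁ (λ τ → Exec (suc (length F * 8)) scan τ
                                 (Scanned (mem σ) (out σ) w k i c b j (x ∷ F)))
    choose with eval-better {σ = σ₁} {x = e#} {y = f#} e≡ refl
    ... | inj₁ (ev , b≼x) = branch ev (end (add one≡ j≡ (fits j<n))
      (mapExec (keep b≼x x≡ ↭-refl (λ _ → refl))
        (scan-correct F (champion R i≡ c≡ b≡ e≡ seg) refl (room j eq))))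
    ... | inj₂ (ev , x≼b) = branch ev (store j≡ j<n ▸ copy ▸ copy ▸ end (add one≡ j≡ (fits j<n))
      (mapExec
        (keep x≼b (≡-trans (update-same (mem σ) j _) b≡) (swap x b ↭-refl)
          (λ h<j → update-other (mem σ) _ (>⇒≢ h<j)))
        (scan-correct F
          (champion R i≡ c≡ x≡ refl (Segment-store-below F ≤-refl seg)) refl (room j eq))))

  -- Matching off the stack once no points are free.

  unwind-correct : ∀ C {σ w} → Regs σ w (length C) → Stack (mem σ) C → length C ≤ n →
                   Chain [] C →
                   Exec (suc (length C * 6)) unwind σ (λ τ → Solved (out σ) (C ++ []) (out τ))
  unwind-correct [] (_ , _ , k≡ , one≡ , _) _ _ _ =
    loop-exit (eval-less-false one≡ k≡ z≤n) ([] , stop z<s , ↭-refl)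
  unwind-correct (c ∷ []) (_ , _ , k≡ , one≡ , _) _ _ _ =
    loop-exit (eval-less-false one≡ k≡ ≤-refl) ([] , stop ≤-refl , ↭-refl)
  unwind-correct (c ∷ c′ ∷ C) (n≡ , w≡ , k≡ , one≡ , zero≡) (c≡ , c′≡ , st) C≤n ch =
    -- A round takes six units and removes two points, for which the bound allots twelve.
    slower (s≤s (m≤n+m _ 6))
      (loop-step {T = 5} (eval-less-true one≡ k≡ (s≤s z<s))
        (sub k≡ one≡ ▸ load refl C≤n ▸ sub refl one≡ ▸ load refl (<⇒≤ C≤n) ▸
         end (report c≡ c′≡)
          (mapExec (Solved-pair (top-dominant (λ ()) ch))
            (unwind-correct C (n≡ , w≡ , refl , one≡ , zero≡) st
              (<⇒≤ (<⇒≤ C≤n)) (Chain-pop₂ ch)))))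

  -- The main loop.

  record Inv (σ : State) (F C : List P) : Set (α ⊔ β ⊔ ℓ₂) where
    constructor inv
    field
      {w}   : ℕ
      regs  : Regs σ w (length C)
      seg   : Segment (mem σ) w F
      stack : Stack (mem σ) C
      size  : w + length F ≡ n
      -- The stack and the free segment do not overlap, so `n` cells suffice.
      C≤w   : length C ≤ w
      chain : Chain F C

  -- Describes the entire remaining execution, unwinding included, because the greedy run is only
  -- known at its end.
  Next : List (P × P) → ℕ → List P → State → Set (α ⊔ β ⊔ ℓ₂)
  Next o U xs τ =
    Exec U grow τ (λ ρ → Exec (suc (n * 6)) unwind ρ (λ ρ′ → Solved o xs (out ρ′)))

  Next-map : ∀ {o o′ U xs ys τ} → (∀ {p} → Solved o xs p → Solved o′ ys p) →
             Next o U xs τ → Next o′ U ys τ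
  Next-map f = mapExec (mapExec f)

  -- A push trades a free point of weight two for a stack point of weight one; a match removes two
  -- stack points.
  measure : List P → List P → ℕ
  measure F C = length F * 2 + length C

  -- The induction hypothesis of `grow-correct`, abstracted so that one round can be verified
  -- separately.
  GrowsBelow : ℕ → ℕ → Set (α ⊔ β ⊔ ℓ₂)
  GrowsBelow U B = ∀ {τ F C} → Inv τ F C → measure F C < B → Next (out τ) U (C ++ F) τ

  push-correct : ∀ {σ w U B b F C xs} → GrowsBelow U B →
                 Regs σ w (length C) → reg σ b# ≡ point b →
                 Segment (mem σ) w F → Stack (mem σ) C → w + length F ≡ n →
                 length C < w → Chain F (b ∷ C) → b ∷ (C ++ F) ↭ xs →
                 suc (measure F C) < B →
                 Exec (suc (suc T)) push σ (Next (out σ) U xs)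
  push-correct {σ = σ} {w} {B = B} {F = F} {C} rec (n≡ , w≡ , k≡ , one≡ , zero≡)
    b≡ seg st size C<w ch ↭xs <B =
    store k≡ (<-≤-trans C<w w≤n) ▸
    end (add one≡ k≡ (fits (≤-trans C<w w≤n)))
      (Next-map (Solved-resp-↭ ↭xs)
        (rec
          (inv (n≡ , w≡ , refl , one≡ , zero≡) (Segment-store-below F C<w seg)
            (≡-trans (update-same (mem σ) (length C) _) b≡ , Stack-store-above C ≤-refl st)
            size C<w ch)
          (subst (_< B) (≡-sym (+-suc (length F * 2) _)) <B)))
    where
    w≤n : w ≤ n
    w≤n = below-n size

  -- Seven units up to the scan, the scan of at most `n` points, and nine for the longest decision
  -- afterwards.
  bodyTime : ℕ
  bodyTime = 7 + (suc (n * 8) + 9)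

  growBody-correct : ∀ {σ U b F C} → Inv σ (b ∷ F) C → GrowsBelow U (measure (b ∷ F) C) →
                     Exec bodyTime growBody σ (Next (out σ) U (C ++ b ∷ F))
  growBody-correct {σ} {U} {b} {F} {C}
    (inv {w} (n≡ , w≡ , k≡ , one≡ , zero≡) (b≡ , seg) st size C≤w ch) rec =
    load w≡ w<n ▸ add one≡ w≡ (fits w<n) ▸ split C st C≤w ch k≡ rec
    where
    w<n : w < n
    w<n = below-n (room w size)
    σ₁ : State
    σ₁ = setReg w# (number (suc w)) (setReg b# (mem σ w) σ)
    regroup : ∀ {b′ G} C → b′ ∷ G ↭ b ∷ F → b′ ∷ (C ++ G) ↭ C ++ b ∷ F
    regroup C perm = trans (↭-sym (shift _ C _)) (++⁺ˡ C perm)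
    -- `C` is quantified anew, so that the case distinction comes after the two common instructions.
    split : ∀ C → Stack (mem σ) C → length C ≤ w → Chain (b ∷ F) C →
            reg σ k# ≡ number (length C) → GrowsBelow U (measure (b ∷ F) C) →
            Exec _ (cond (equal k# zero#) push extend) σ₁ (Next (out σ) U (C ++ b ∷ F))
    split [] st C≤w ch k≡ rec =
      branch (equal k≡ zero≡)
        (push-correct rec (n≡ , refl , k≡ , one≡ , zero≡) b≡ seg st (room w size) z<s single
          ↭-refl ≤-refl)
    split (c ∷ C) st@(c≡ , st′) C≤w ch k≡ rec =
      branch (equal k≡ zero≡)
        (sub k≡ one≡ ▸ load refl (≤-<-trans (<⇒≤ C≤w) w<n) ▸ dist c≡ b≡ ▸ copy ▸
         seq (mapExec (continue C st C≤w ch rec)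
           (slower (s≤s (*-monoˡ-≤ 8 F≤n))
             (scan-correct F (champion (n≡ , refl , k≡ , one≡ , zero≡) refl c≡ b≡ refl seg)
               refl (room w size)))))
      where
      F≤n : length F ≤ n
      F≤n = subst (length F ≤_) (room w size) (m≤n+m _ (suc w))
      continue : ∀ C → Stack (mem σ) (c ∷ C) → length (c ∷ C) ≤ w → Chain (b ∷ F) (c ∷ C) →
                 GrowsBelow U (measure (b ∷ F) (c ∷ C)) → ∀ {τ} →
                 Scanned (mem σ) (out σ) (suc w) (suc (length C)) (length C) c b (suc w) F τ →
                 Exec 9 (cond (equal k# one#) push matchOrPush) τ
                   (Next (out σ) U (c ∷ C ++ b ∷ F))
      continue C st C≤w ch rec {τ}
        (scanned {b′} {G} (champion (n≡ , w≡ , k≡ , one≡ , zero≡) i≡ c≡ b≡ e≡ seg)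
          perm near frame out≡) =
        subst (λ o → Exec 9 _ τ (Next o U (c ∷ C ++ b ∷ F))) out≡
          (decide C (Stack-cong (c ∷ C) (λ h<C → frame (m≤n⇒m≤1+n (<-≤-trans h<C C≤w))) st)
            C≤w (Chain-⊆ (∈-resp-↭ perm) ch) rec k≡ i≡)
        where
        sizes : length G ≡ length F
        sizes = suc-injective (↭-length perm)
        size′ : suc w + length G ≡ n
        size′ = ≡-trans (cong (suc w +_) sizes) (room w size)
        pushed : ∀ C → Regs τ (suc w) (length C) → Stack (mem τ) C → length C ≤ w →
                 Chain G (b′ ∷ C) → GrowsBelow U (measure (b ∷ F) C) → ∀ {T} →
                 Exec (suc (suc T)) push τ (Next (out τ) U (C ++ b ∷ F))
        pushed C R st C≤w ch rec =
          push-correct rec R b≡ seg st size′ (s≤s C≤w) ch (regroup C perm)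
            (≤-reflexive (cong (λ l → suc (suc (l * 2 + length C))) sizes))
        decide : ∀ C → Stack (mem τ) (c ∷ C) → length (c ∷ C) ≤ w → Chain (b′ ∷ G) (c ∷ C) →
                 GrowsBelow U (measure (b ∷ F) (c ∷ C)) →
                 reg τ k# ≡ number (suc (length C)) → reg τ i# ≡ number (length C) →
                 Exec 9 (cond (equal k# one#) push matchOrPush) τ
                   (Next (out τ) U (c ∷ C ++ b ∷ F))
        decide [] st C≤w ch rec k≡ i≡ =
          branch (equal k≡ one≡)
            (pushed (c ∷ []) (n≡ , w≡ , k≡ , one≡ , zero≡) st C≤w (link-single near) rec)
        decide (c′ ∷ C) st@(_ , c′≡ , st′) C≤w ch rec k≡ i≡ =
          branch (equal k≡ one≡)
            (sub i≡ one≡ ▸ load refl (<-trans (<⇒≤ C≤w) w<n) ▸ dist c≡ c′≡ ▸ matchOrPush′)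
          where
          τ₁ : State
          τ₁ = setReg f# (distance (d c c′))
                 (setReg a# (mem τ (length C)) (setReg i# (number (length C)) τ))
          matchOrPush′ : Exec 5 _ τ₁ (Next (out τ) U (c ∷ c′ ∷ C ++ b ∷ F))
          matchOrPush′ with eval-better {σ = τ₁} {x = f#} {y = e#} refl e≡
          ... | inj₂ (ev , cb≼cc′) = branch ev
            (push-correct rec (n≡ , w≡ , k≡ , one≡ , zero≡) b≡ seg st size′ (s≤s C≤w)
              (link-nearer near cb≼cc′ ch) (regroup (c ∷ c′ ∷ C) perm)
              (≤-reflexive (cong (λ l → suc (suc (l * 2 + length (c ∷ c′ ∷ C)))) sizes)))
          ... | inj₁ (ev , cc′≼cb) = branch ev
            -- With `b′` back in cell `w`, the free points are the old ones up to order; only the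
            -- two matched points are gone.
            (report c≡ c′≡ ▸ copy ▸ sub w≡ one≡ ▸ end (store refl w<n)
              (Next-map
                (Solved-resp-↭ (prep c (prep c′ (++⁺ˡ C perm))) ∘
                 Solved-pair (top-dominant near₂ ch))
                (rec
                  (inv (n≡ , refl , refl , one≡ , zero≡)
                    (≡-trans (update-same (mem τ) w _) b≡ , Segment-store-below G ≤-refl seg)
                    (Stack-store-above C C≤w′ st′) (≡-trans (+-suc w _) size′) C≤w′
                    (Chain-pop₂ ch))
                  lower)))
            where
            near₂ : ∀ {y} → y ∈ b′ ∷ G → d c c′ ≼ d c y
            near₂ y∈ = ≼-trans cc′≼cb (near y∈)
            C≤w′ : length C ≤ w
            C≤w′ = <⇒≤ (<⇒≤ C≤w)
            lower : measure (b′ ∷ G) C < measure (b ∷ F) (c ∷ c′ ∷ C)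
            lower = subst
              (λ l → measure (b′ ∷ G) C < suc (suc (l * 2 + length (c ∷ c′ ∷ C)))) sizes
              (s≤s (s≤s (+-monoʳ-< (length G * 2) (m≤n⇒m≤1+n ≤-refl))))

  -- `B` is the fuel of the recursion and bounds the number of loop tests.
  grow-correct : ∀ B {σ F C} → Inv σ F C → measure F C < B →
                 Next (out σ) (B * suc bodyTime) (C ++ F) σ
  grow-correct (suc B) {F = []} {C} (inv {w} R@(n≡ , w≡ , _) _ st size C≤w ch) _ =
    loop-exit (eval-less-false w≡ n≡ (≤-reflexive (≡-trans (≡-sym size) (+-identityʳ w))))
      (slower (s≤s (*-monoˡ-≤ 6 C≤n)) (unwind-correct C R st C≤n ch))
    where
    C≤n : length C ≤ n
    C≤n = ≤-trans C≤w (below-n size)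
  grow-correct (suc B) {F = b ∷ F} I@(inv {w} (n≡ , w≡ , _) _ _ size _ _) (s≤s ≤B) =
    loop-step (eval-less-true w≡ n≡ (below-n (room w size)))
      (growBody-correct I (λ I′ lt → grow-correct B I′ (<-≤-trans lt ≤B)))

  -- The whole program.

  programTime : ℕ
  programTime = suc (suc (n * 2) * suc bodyTime + suc (n * 6))

  program-correct : ∀ xs → length xs ≡ n →
    Exec programTime program (initial xs) (IsGreedyMatching xs ∘ out)
  program-correct xs refl =
    const 1<2^width ▸ seq (mapExec (mapExec greedy)
      (grow-correct _
        (inv (refl , refl , refl , refl , refl) (Segment-input xs) tt refl z≤n empty)
        -- The stack starts empty, so the initial measure is `n * 2` and the fuel is one more.
        (s≤s (≤-reflexive (+-identityʳ _)))))
    where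
    greedy : ∀ {o} → Solved [] xs o → IsGreedyMatching xs o
    greedy (m , run , o↭) = m , run , trans o↭ (↭-reflexive (++-identityʳ m))

-- Asymptotic bounds.

∈O-refl : ∀ f → f ∈O f
∈O-refl f = 1 , 0 , λ n _ → ≤-reflexive (≡-sym (*-identityˡ (f n)))

∈O-trans : ∀ {f g h} → f ∈O g → g ∈O h → f ∈O h
∈O-trans {f} {g} {h} (c , n₀ , f≤) (c′ , n₁ , g≤) = c * c′ , n₀ + n₁ , λ n n≥ → begin
  f n             ≤⟨ f≤ n (≤-trans (m≤m+n n₀ n₁) n≥) ⟩
  c * g n         ≤⟨ *-monoʳ-≤ c (g≤ n (≤-trans (m≤n+m n₁ n₀) n≥)) ⟩
  c * (c′ * h n)  ≡⟨ *-assoc c c′ (h n) ⟨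
  c * c′ * h n    ∎
  where open ≤-Reasoning

-- `programTime` unfolded, as a function of `n` alone.
time : ℕ → ℕ
time n = suc (suc (n * 2) * (8 + (suc (n * 8) + 9)) + suc (n * 6))

time∈O[n²] : time ∈O (λ n → n ^ 2)
-- The time is 16n² + 50n + 20, and 86 is the sum of the coefficients; at n = m + 1 the slack is
-- 70m² + 90m.
time∈O[n²] = 86 , 1 , λ { (suc m) _ → subst (time (suc m) ≤_) (expand m) (m≤m+n _ _) }
  where
  open import Data.Nat.Tactic.RingSolver using (solve-∀)
  expand : ∀ m → suc (suc (suc m * 2) * (8 + (suc (suc m * 8) + 9)) + suc (suc m * 6))
                 + (70 * (m * m) + 90 * m) ≡ 86 * (suc m * (suc m * 1))
  expand = solve-∀

n²∈O[n²log²n] : (λ n → n ^ 2) ∈O (λ n → n ^ 2 * ⌊log₂ n ⌋ ^ 2)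
-- From 2 on, the logarithm is at least one.
n²∈O[n²log²n] = 1 , 2 , λ n 2≤n → begin
  n ^ 2                        ≡⟨ *-identityʳ (n ^ 2) ⟨
  n ^ 2 * 1 ^ 2                ≤⟨ *-monoʳ-≤ (n ^ 2) (^-monoˡ-≤ 2 (1≤⌊log₂n⌋ 2≤n)) ⟩
  n ^ 2 * ⌊log₂ n ⌋ ^ 2        ≡⟨ *-identityˡ _ ⟨
  1 * (n ^ 2 * ⌊log₂ n ⌋ ^ 2)  ∎
  where open ≤-Reasoning

width∈O[log] : (λ n → suc ⌊log₂ n ⌋) ∈O ⌊log₂_⌋
width∈O[log] = 2 , 2 , λ n 2≤n →
  subst (suc ⌊log₂ n ⌋ ≤_) (cong (⌊log₂ n ⌋ +_) (≡-sym (+-identityʳ _)))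
    (+-monoˡ-≤ ⌊log₂ n ⌋ (1≤⌊log₂n⌋ 2≤n))

1<2^suc : ∀ w → 1 < 2 ^ suc w
1<2^suc w = *-monoʳ-≤ 2 (m^n>0 2 w)

-- Quadratic time and exactly `n` cells hold at once, which gives both halves of the theorem.
greedyMatching-linearSpace : (a b ℓ₁ ℓ₂ : Level) (obj : Objective) →
                             GreedyMatchingIn a b ℓ₁ ℓ₂ obj time id
greedyMatching-linearSpace a b ℓ₁ ℓ₂ obj =
  Program.program obj , (λ n → suc ⌊log₂ n ⌋) , width∈O[log] , n<2^[1+⌊log₂n⌋] ,
  (λ _ → ≤-refl) ,
  λ P D d d-sym xs _ →
    Correctness.program-correct D d d-sym obj (length xs) (suc ⌊log₂ length xs ⌋)
      (n<2^[1+⌊log₂n⌋] _) (1<2^suc ⌊log₂ length xs ⌋) xs refl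

theorem6 : (a b ℓ₁ ℓ₂ : Level) (obj : Objective) →
    (∃₂ λ (T S : ℕ → ℕ) →
    T ∈O (λ n → n ^ 2 * ⌊log₂ n ⌋ ^ 2) ×
    S ∈O (λ n → n) ×
    GreedyMatchingIn a b ℓ₁ ℓ₂ obj T S)
    ×
    (∃₂ λ (T S : ℕ → ℕ) →
    T ∈O (λ n → n ^ 2) ×
    GreedyMatchingIn a b ℓ₁ ℓ₂ obj T S)
theorem6 a b ℓ₁ ℓ₂ obj =
  (time , id , ∈O-trans time∈O[n²] n²∈O[n²log²n] , ∈O-refl id ,
    greedyMatching-linearSpace a b ℓ₁ ℓ₂ obj) ,
  (time , id , time∈O[n²] , greedyMatching-linearSpace a b ℓ₁ ℓ₂ obj)
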